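{- $t(K(11,4))=\frac{7}{4}$. Moreover, if $S$ is a vertex cut of $K(11,4)$ such that $\frac{|S|}{c(K(11,4)\setminus S)} = \frac{7}{4}$, then $S$ is the complement of a maximum independent set of $K(11,4)$.
   Context: The Kneser graph $K(n,k)$ has as vertices the $k$-element subsets of $[n]=\{1,\dots,n\}$, two vertices adjacent iff the subsets are disjoint. A vertex cut is a set $S$ of vertices whose removal disconnects the graph; $c(G\setminus S)$ is the number of connected components after deleting $S$; the toughness is $t(G)=\min_S |S|/c(G\setminus S)$ over all vertex cuts $S$. -}

module Defs where

open import Data.Bool using (Bool; true; false; not)
open import Data.Nat using (ℕ; zero; suc; _≤_; _*_)
open import Data.Fin using (Fin)
open import Data.Fin.Subset using (Subset; ∣_∣; _∩_; Empty)
open import Data.Vec using (_∷_; [])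
open import Data.List using (List; map; _++_; filter; length; [_])
open import Data.Product using (Σ; _×_; ∃)
open import Function using (Surjective; _⇔_)
open import Relation.Binary.PropositionalEquality using (_≡_)
open import Relation.Nullary using (¬_)
open import Data.Nat.Properties using (_≟_)

-- Kneser graph K(n,k): vertices are the k-subsets of Fin n
-- (subsets encoded as characteristic vectors, Data.Fin.Subset),
-- adjacency = disjointness.

IsVertex : (n k : ℕ) → Subset n → Set
IsVertex n k A = ∣ A ∣ ≡ k

Adj : {n : ℕ} → Subset n → Subset n → Set
Adj A B = Empty (A ∩ B)

allSubsets : (n : ℕ) → List (Subset n)
allSubsets zero = [ [] ]
allSubsets (suc n) = map (false ∷_) (allSubsets n) ++ map (true ∷_) (allSubsets n)

vertices : (n k : ℕ) → List (Subset n)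
vertices n k = filter (λ A → ∣ A ∣ ≟ k) (allSubsets n)

-- a set of vertices is given by its (Boolean) characteristic function;
-- only its values on vertices matter
VSet : ℕ → Set
VSet n = Subset n → Bool

card : (n k : ℕ) → VSet n → ℕ
card n k S = length (filter (λ A → S A Data.Bool.≟ true) (vertices n k))

Remaining : (n k : ℕ) → VSet n → Subset n → Set
Remaining n k S A = IsVertex n k A × S A ≡ false

data Reach (n k : ℕ) (S : VSet n) : Subset n → Subset n → Set where
  here : ∀ {A} → Remaining n k S A → Reach n k S A A
  step : ∀ {A B C} → Remaining n k S A → Adj A B →
         Reach n k S B C → Reach n k S A C

RemV : (n k : ℕ) → VSet n → Set
RemV n k S = Σ (Subset n) (Remaining n k S)

-- K(n,k) \ S has exactly c connected components: there is a surjective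
-- labelling of its vertices by Fin c whose fibres are exactly the
-- connected components.
HasComponents : (n k : ℕ) → VSet n → ℕ → Set
HasComponents n k S c =
  Σ (RemV n k S → Fin c) λ f →
    Surjective _≡_ _≡_ f ×
    ((u v : RemV n k S) → (f u ≡ f v) ⇔ Reach n k S (Σ.proj₁ u) (Σ.proj₁ v))

IsVertexCut : (n k : ℕ) → VSet n → Set
IsVertexCut n k S =
  Σ (Subset n) λ A → Σ (Subset n) λ B →
    Remaining n k S A × Remaining n k S B × ¬ Reach n k S A B

IsIndependent : (n k : ℕ) → VSet n → Set
IsIndependent n k I = (A B : Subset n) → IsVertex n k A → IsVertex n k B →
  I A ≡ true → I B ≡ true → ¬ Adj A B

IsMaxIndependent : (n k : ℕ) → VSet n → Set
IsMaxIndependent n k I = IsIndependent n k I ×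
  ((J : VSet n) → IsIndependent n k J → card n k J ≤ card n k I)

IsComplementOf : (n k : ℕ) → VSet n → VSet n → Set
IsComplementOf n k S I = (A : Subset n) → IsVertex n k A → S A ≡ not (I A)

{-# OPTIONS --safe #-}

-- Let S be a cut with s vertices and c components, and suppose 4 s ≤ 7 c.
-- Write N = 330 - s = 120 + t for the number of remaining vertices and
-- x = n - 1 for the excess of a component with n vertices; the excesses add
-- up to X = N - c, and 7 X ≤ 11 t.  The least eigenvalue -20 of K(11,4) gives
-- N t ≤ 6 E, where E is twice the number of remaining edges, while the second
-- eigenvalue 10 (for n ≥ 12) and the trivial bound n (n - 1) (for n ≤ 11) show
-- that a component contributes at most (7 N - 1) x / 66 to E.  Together
-- 11 N t ≤ 66 E ≤ 7 N X - X ≤ 11 N t - X, so X = 0: every component is a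
-- single vertex, whence E = 0, t = 0 and N = c = 120.
--
-- Both eigenvalue bounds say that a quadratic form whose coefficient at (A , B)
-- depends only on |A ∩ B| is nonnegative.  Each is written as a sum of squares
-- Σ_T (Σ_A c(|A ∩ T|) f(A))², whose coefficients depend only on |A ∩ B| because
-- Σ_T g(|T|, |A ∩ T|, |B ∩ T|) does not change when the ground set is permuted.

module Submission where

open import Defs
open import Algebra.Properties.CommutativeSemigroup using (interchange)
open import Data.Bool as Bool using (Bool; true; false; not; if_then_else_)
open import Data.Bool.Properties using (not-involutive)
open import Data.Fin as Fin using (Fin; zero; suc; _↑ˡ_; _↑ʳ_)
import Data.Fin.Properties as Fin
open import Data.Fin.Subset using (Subset; ∣_∣; _∩_; Empty)
open import Data.Fin.Subset.Properties
  using (∣p∩q∣≤∣p∣; ∣p∩q∣≤∣q∣; ∩-idem; Empty-unique; ∣⊥∣≡0)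
open import Data.Integer
  using (ℤ; +_; -[1+_]; 0ℤ; 1ℤ; _+_; _*_; _-_; -_; _≤_; +≤+; Positive; nonNegative)
import Data.Integer.Properties as ℤ
open import Data.Integer.Tactic.RingSolver using (solve-∀)
open import Data.List using (List; []; _∷_; map; _++_; replicate; allFin; filter; length)
open import Data.List.Properties using (map-tabulate)
open import Data.List.Relation.Binary.Permutation.Propositional as Perm
  using (_↭_; prep; swap; ↭-refl; ↭-sym; ↭-trans)
open import Data.List.Relation.Binary.Permutation.Propositional.Properties using (shift; ++⁺ˡ)
open import Data.Nat as ℕ using (ℕ; zero; suc; z≤n; s≤s)
import Data.Nat.Properties as ℕ
open import Data.Product using (Σ; _×_; _,_; ∃; proj₁; proj₂)
open import Data.Sum using (inj₁; inj₂)
open import Data.Vec using ([]; _∷_; head; tail; here; there)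
open import Data.Vec.Properties using (≡-dec)
open import Function using (_∘_; id; _⇔_; mk⇔; Equivalence)
open import Relation.Binary.PropositionalEquality
open import Relation.Nullary using (¬_; Dec; yes; no; does; contradiction)
open import Relation.Nullary.Decidable using (_×-dec_)

private
  variable
    V W : Set

-- Finite sums

∑ : List V → (V → ℤ) → ℤ
∑ []       f = 0ℤ
∑ (x ∷ xs) f = f x + ∑ xs f

∑-cong : ∀ (xs : List V) {f g : V → ℤ} → (∀ x → f x ≡ g x) → ∑ xs f ≡ ∑ xs g
∑-cong []       eq = refl
∑-cong (x ∷ xs) eq = cong₂ _+_ (eq x) (∑-cong xs eq)

∑-mono : ∀ (xs : List V) {f g : V → ℤ} → (∀ x → f x ≤ g x) → ∑ xs f ≤ ∑ xs g
∑-mono []       le = ℤ.≤-refl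
∑-mono (x ∷ xs) le = ℤ.+-mono-≤ (le x) (∑-mono xs le)

∑-zero : ∀ (xs : List V) → ∑ xs (λ _ → 0ℤ) ≡ 0ℤ
∑-zero []       = refl
∑-zero (x ∷ xs) = trans (ℤ.+-identityˡ _) (∑-zero xs)

∑-nonneg : ∀ (xs : List V) {f : V → ℤ} → (∀ x → 0ℤ ≤ f x) → 0ℤ ≤ ∑ xs f
∑-nonneg xs {f} le = subst (_≤ ∑ xs f) (∑-zero xs) (∑-mono xs le)

∑-+ : ∀ (xs : List V) (f g : V → ℤ) → ∑ xs (λ x → f x + g x) ≡ ∑ xs f + ∑ xs g
∑-+ []       f g = refl
∑-+ (x ∷ xs) f g = trans (cong (_+_ (f x + g x)) (∑-+ xs f g))
  (interchange ℤ.+-commutativeSemigroup (f x) (g x) _ _)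

∑-*ˡ : ∀ (xs : List V) (a : ℤ) (f : V → ℤ) → ∑ xs (λ x → a * f x) ≡ a * ∑ xs f
∑-*ˡ []       a f = sym (ℤ.*-zeroʳ a)
∑-*ˡ (x ∷ xs) a f = trans (cong (_+_ (a * f x)) (∑-*ˡ xs a f)) (sym (ℤ.*-distribˡ-+ a (f x) _))

∑-swap : ∀ (xs : List V) (ys : List W) (f : V → W → ℤ) →
  ∑ xs (λ x → ∑ ys (f x)) ≡ ∑ ys (λ y → ∑ xs (λ x → f x y))
∑-swap []       ys f = sym (∑-zero ys)
∑-swap (x ∷ xs) ys f = trans (cong (_+_ (∑ ys (f x))) (∑-swap xs ys f)) (sym (∑-+ ys (f x) _))

∑-product : ∀ (xs : List V) (ys : List W) (f : V → ℤ) (g : W → ℤ) →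
  ∑ xs f * ∑ ys g ≡ ∑ xs (λ x → ∑ ys (λ y → f x * g y))
∑-product xs ys f g = begin
  ∑ xs f * ∑ ys g                      ≡⟨ ℤ.*-comm (∑ xs f) (∑ ys g) ⟩
  ∑ ys g * ∑ xs f                      ≡⟨ ∑-*ˡ xs (∑ ys g) f ⟨
  ∑ xs (λ x → ∑ ys g * f x)
    ≡⟨ ∑-cong xs (λ x → trans (ℤ.*-comm (∑ ys g) (f x)) (sym (∑-*ˡ ys (f x) g))) ⟩
  ∑ xs (λ x → ∑ ys (λ y → f x * g y))  ∎
  where open ≡-Reasoning

∑-++ : ∀ (xs ys : List V) (f : V → ℤ) → ∑ (xs ++ ys) f ≡ ∑ xs f + ∑ ys f
∑-++ []       ys f = sym (ℤ.+-identityˡ _)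
∑-++ (x ∷ xs) ys f = trans (cong (_+_ (f x)) (∑-++ xs ys f)) (sym (ℤ.+-assoc (f x) _ _))

∑-map : ∀ (h : V → W) (xs : List V) (f : W → ℤ) → ∑ (map h xs) f ≡ ∑ xs (f ∘ h)
∑-map h []       f = refl
∑-map h (x ∷ xs) f = cong (_+_ (f (h x))) (∑-map h xs f)

opaque
  subsets : (n : ℕ) → List (Subset n)
  subsets = allSubsets

  subsets≡allSubsets : ∀ n → subsets n ≡ allSubsets n
  subsets≡allSubsets n = refl

  ∑-subsets-zero : (f : Subset 0 → ℤ) → ∑ (subsets 0) f ≡ f []
  ∑-subsets-zero f = ℤ.+-identityʳ (f [])

  ∑-subsets-suc : ∀ n (f : Subset (suc n) → ℤ) →
    ∑ (subsets (suc n)) f ≡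
    ∑ (subsets n) (f ∘ (false ∷_)) + ∑ (subsets n) (f ∘ (true ∷_))
  ∑-subsets-suc n f = trans (∑-++ (map (false ∷_) (allSubsets n)) _ f)
    (cong₂ _+_ (∑-map (false ∷_) (allSubsets n) f) (∑-map (true ∷_) (allSubsets n) f))

-- Sums over all subsets T that depend only on |T|, |A ∩ T| and |B ∩ T|

Columns : Set
Columns = List (Bool × Bool)

columns : ∀ {n} → Subset n → Subset n → Columns
columns []      []      = []
columns (a ∷ A) (b ∷ B) = (a , b) ∷ columns A B

bit : Bool → ℕ → ℕ
bit true  = suc
bit false = λ m → m

columnSum : Columns → (ℕ → ℕ → ℕ → ℤ) → ℤ
columnSum []             g = g 0 0 0
columnSum ((a , b) ∷ cs) g =
  columnSum cs g + columnSum cs (λ t p q → g (suc t) (bit a p) (bit b q))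

∑-columns : ∀ {n} (A B : Subset n) (g : ℕ → ℕ → ℕ → ℤ) →
  ∑ (subsets n) (λ T → g (∣ T ∣) (∣ A ∩ T ∣) (∣ B ∩ T ∣)) ≡ columnSum (columns A B) g
∑-columns []      []      g = ∑-subsets-zero _
∑-columns {suc n} (a ∷ A) (b ∷ B) g = trans (∑-subsets-suc n _)
  (cong₂ _+_
    (trans (∑-cong (subsets n) (λ T → cong₂ (g ∣ T ∣) (outside a A T) (outside b B T)))
           (∑-columns A B g))
    (trans (∑-cong (subsets n) (λ T → cong₂ (g (suc ∣ T ∣)) (inside a A T) (inside b B T)))
           (∑-columns A B (λ t p q → g (suc t) (bit a p) (bit b q)))))
  where
  outside : ∀ a {n} (A T : Subset n) → ∣ (a ∷ A) ∩ (false ∷ T) ∣ ≡ ∣ A ∩ T ∣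
  outside true  A T = refl
  outside false A T = refl
  inside : ∀ a {n} (A T : Subset n) → ∣ (a ∷ A) ∩ (true ∷ T) ∣ ≡ bit a ∣ A ∩ T ∣
  inside true  A T = refl
  inside false A T = refl

columnSum-cong : ∀ cs {g h : ℕ → ℕ → ℕ → ℤ} → (∀ t p q → g t p q ≡ h t p q) →
  columnSum cs g ≡ columnSum cs h
columnSum-cong []       eq = eq 0 0 0
columnSum-cong (_ ∷ cs) eq =
  cong₂ _+_ (columnSum-cong cs eq) (columnSum-cong cs (λ t p q → eq (suc t) _ _))

bit-comm : ∀ a b m → bit a (bit b m) ≡ bit b (bit a m)
bit-comm true  true  m = refl
bit-comm true  false m = refl
bit-comm false true  m = refl
bit-comm false false m = refl

columnSum-↭ : ∀ {cs ds} → cs ↭ ds → ∀ g → columnSum cs g ≡ columnSum ds g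
columnSum-↭ Perm.refl        g = refl
columnSum-↭ (prep (a , b) r) g = cong₂ _+_ (columnSum-↭ r g) (columnSum-↭ r _)
columnSum-↭ (Perm.trans r s)  g = trans (columnSum-↭ r g) (columnSum-↭ s g)
columnSum-↭ {_ ∷ _ ∷ cs} {_ ∷ _ ∷ ds} (swap (a , b) (c , d) r) g = begin
  (columnSum cs g + columnSum cs g₂) + (columnSum cs g₁ + columnSum cs g₁₂)
    ≡⟨ cong₂ _+_ (cong₂ _+_ (columnSum-↭ r g) (columnSum-↭ r g₂))
                 (cong₂ _+_ (columnSum-↭ r g₁) (trans (columnSum-↭ r g₁₂) (columnSum-cong ds g₁₂≗g₂₁))) ⟩
  (columnSum ds g + columnSum ds g₂) + (columnSum ds g₁ + columnSum ds g₂₁)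
    ≡⟨ interchange ℤ.+-commutativeSemigroup (columnSum ds g) (columnSum ds g₂) (columnSum ds g₁) (columnSum ds g₂₁) ⟩
  (columnSum ds g + columnSum ds g₁) + (columnSum ds g₂ + columnSum ds g₂₁) ∎
  where
  open ≡-Reasoning
  g₁ g₂ g₁₂ g₂₁ : ℕ → ℕ → ℕ → ℤ
  g₁  t p q = g (suc t) (bit a p) (bit b q)
  g₂  t p q = g (suc t) (bit c p) (bit d q)
  g₁₂ t p q = g₁ (suc t) (bit c p) (bit d q)
  g₂₁ t p q = g₂ (suc t) (bit a p) (bit b q)
  g₁₂≗g₂₁ : ∀ t p q → g₁₂ t p q ≡ g₂₁ t p q
  g₁₂≗g₂₁ t p q = cong₂ (g (suc (suc t))) (bit-comm a c p) (bit-comm b d q)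

-- The arguments count the elements of A ∩ B, A \ B, B \ A and of neither set.
sortedColumns : ℕ → ℕ → ℕ → ℕ → Columns
sortedColumns i j k l =
  replicate i (true , true) ++ replicate j (true , false) ++
  replicate k (false , true) ++ replicate l (false , false)

sort-columns : ∀ {n} (A B : Subset n) → ∃ λ j → ∃ λ k → ∃ λ l →
  ∣ A ∣ ≡ ∣ A ∩ B ∣ ℕ.+ j × ∣ B ∣ ≡ ∣ A ∩ B ∣ ℕ.+ k ×
  n ≡ ∣ A ∩ B ∣ ℕ.+ j ℕ.+ k ℕ.+ l × columns A B ↭ sortedColumns ∣ A ∩ B ∣ j k l
sort-columns [] [] = 0 , 0 , 0 , refl , refl , refl , ↭-refl
sort-columns (a ∷ A) (b ∷ B) with sort-columns A B
sort-columns (true ∷ A) (true ∷ B) | j , k , l , p , q , r , s =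
  j , k , l , cong suc p , cong suc q , cong suc r , prep _ s
sort-columns (true ∷ A) (false ∷ B) | j , k , l , p , q , r , s =
  suc j , k , l , trans (cong suc p) (sym (ℕ.+-suc _ j)) , q ,
  trans (cong suc r) (cong (λ m → m ℕ.+ k ℕ.+ l) (sym (ℕ.+-suc _ j))) ,
  ↭-trans (prep _ s) (↭-sym (shift _ (replicate ∣ A ∩ B ∣ _) _))
sort-columns (false ∷ A) (true ∷ B) | j , k , l , p , q , r , s =
  j , suc k , l , p , trans (cong suc q) (sym (ℕ.+-suc _ k)) ,
  trans (cong suc r) (cong (ℕ._+ l) (sym (ℕ.+-suc _ k))) ,
  ↭-trans (prep _ s) (↭-sym (↭-trans
    (++⁺ˡ (replicate ∣ A ∩ B ∣ _) (shift _ (replicate j _) _))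
    (shift _ (replicate ∣ A ∩ B ∣ _) _)))
sort-columns (false ∷ A) (false ∷ B) | j , k , l , p , q , r , s =
  j , k , suc l , p , q , trans (cong suc r) (sym (ℕ.+-suc _ l)) ,
  ↭-trans (prep _ s) (↭-sym (↭-trans
    (++⁺ˡ (replicate ∣ A ∩ B ∣ _) (++⁺ˡ (replicate j _) (shift _ (replicate k _) _))) (↭-trans
    (++⁺ˡ (replicate ∣ A ∩ B ∣ _) (shift _ (replicate j _) _))
    (shift _ (replicate ∣ A ∩ B ∣ _) _))))

pairSum : (n k i : ℕ) → (ℕ → ℕ → ℕ → ℤ) → ℤ
pairSum n k i = columnSum (sortedColumns i (k ℕ.∸ i) (k ℕ.∸ i) (n ℕ.∸ (k ℕ.+ (k ℕ.∸ i))))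

∑-pair : ∀ {n k} (A B : Subset n) → ∣ A ∣ ≡ k → ∣ B ∣ ≡ k → (g : ℕ → ℕ → ℕ → ℤ) →
  ∑ (subsets n) (λ T → g (∣ T ∣) (∣ A ∩ T ∣) (∣ B ∩ T ∣)) ≡ pairSum n k ∣ A ∩ B ∣ g
∑-pair {n} {k} A B |A|≡k |B|≡k g with sort-columns A B
... | j , j′ , l , p , q , r , s = begin
  ∑ (subsets n) (λ T → g (∣ T ∣) (∣ A ∩ T ∣) (∣ B ∩ T ∣))  ≡⟨ ∑-columns A B g ⟩
  columnSum (columns A B) g                            ≡⟨ columnSum-↭ s g ⟩
  columnSum (sortedColumns i j j′ l) g
    ≡⟨ cong (λ cs → columnSum cs g) (trans (cong (λ m → sortedColumns i m j′ l) j≡)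
         (cong₂ (sortedColumns i (k ℕ.∸ i)) j′≡ l≡)) ⟩
  pairSum n k i g                                      ∎
  where
  open ≡-Reasoning
  i = ∣ A ∩ B ∣
  j≡ : j ≡ k ℕ.∸ i
  j≡ = trans (sym (ℕ.m+n∸m≡n i j)) (cong (ℕ._∸ i) (trans (sym p) |A|≡k))
  j′≡ : j′ ≡ k ℕ.∸ i
  j′≡ = trans (sym (ℕ.m+n∸m≡n i j′)) (cong (ℕ._∸ i) (trans (sym q) |B|≡k))
  l≡ : l ≡ n ℕ.∸ (k ℕ.+ (k ℕ.∸ i))
  l≡ = trans (sym (ℕ.m+n∸m≡n (i ℕ.+ j ℕ.+ j′) l))
    (cong₂ ℕ._∸_ (sym r) (cong₂ ℕ._+_ (trans (sym p) |A|≡k) j′≡))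

-- Quadratic forms indexed by intersection sizes

⟦_⟧ : ∀ {P : Set} → Dec P → ℤ
⟦ P? ⟧ = if does P? then 1ℤ else 0ℤ

⟦⟧-yes : ∀ {P : Set} (P? : Dec P) → P → ⟦ P? ⟧ ≡ 1ℤ
⟦⟧-yes (yes _) p = refl
⟦⟧-yes (no ¬p) p = contradiction p ¬p

⟦⟧-no : ∀ {P : Set} (P? : Dec P) → ¬ P → ⟦ P? ⟧ ≡ 0ℤ
⟦⟧-no (yes p) ¬p = contradiction p ¬p
⟦⟧-no (no _)  ¬p = refl

⟦⟧-nonneg : ∀ {P : Set} (P? : Dec P) → 0ℤ ≤ ⟦ P? ⟧
⟦⟧-nonneg (yes _) = +≤+ z≤n
⟦⟧-nonneg (no _)  = +≤+ z≤n

⟦⟧≤1 : ∀ {P : Set} (P? : Dec P) → ⟦ P? ⟧ ≤ 1ℤ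
⟦⟧≤1 (yes _) = ℤ.≤-refl
⟦⟧≤1 (no _)  = +≤+ z≤n

⟦⟧-idem : ∀ {P : Set} (P? : Dec P) → ⟦ P? ⟧ * ⟦ P? ⟧ ≡ ⟦ P? ⟧
⟦⟧-idem (yes _) = refl
⟦⟧-idem (no _)  = refl

[_≈_] : ℕ → ℕ → ℤ
[ m ≈ n ] = ⟦ m ℕ.≟ n ⟧

*-nonneg : ∀ {a b} → 0ℤ ≤ a → 0ℤ ≤ b → 0ℤ ≤ a * b
*-nonneg {a} {b} 0≤a 0≤b = subst (_≤ a * b) (ℤ.*-zeroʳ a)
  (ℤ.*-monoˡ-≤-nonNeg a {{nonNegative 0≤a}} 0≤b)

square-nonneg : ∀ a → 0ℤ ≤ a * a
square-nonneg (+ n)      = *-nonneg {+ n} {+ n} (+≤+ z≤n) (+≤+ z≤n)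
square-nonneg (-[1+ n ]) = +≤+ z≤n

Supported : (n k : ℕ) → (Subset n → ℤ) → Set
Supported n k f = ∀ A → ∣ A ∣ ≢ k → f A ≡ 0ℤ

total : ∀ {n} → (Subset n → ℤ) → ℤ
total {n} = ∑ (subsets n)

form : ∀ {n} → (ℕ → ℤ) → (Subset n → ℤ) → ℤ
form κ f = total (λ A → total (λ B → f A * f B * κ ∣ A ∩ B ∣))

form-+ : ∀ {n} (κ μ : ℕ → ℤ) (f : Subset n → ℤ) →
  form (λ i → κ i + μ i) f ≡ form κ f + form μ f
form-+ {n} κ μ f = trans
  (∑-cong (subsets n) (λ A → trans
    (∑-cong (subsets n) (λ B → ℤ.*-distribˡ-+ (f A * f B) (κ _) (μ _)))
    (∑-+ (subsets n) _ _)))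
  (∑-+ (subsets n) _ _)

form-* : ∀ {n} (a : ℤ) (κ : ℕ → ℤ) (f : Subset n → ℤ) →
  form (λ i → a * κ i) f ≡ a * form κ f
form-* {n} a κ f = trans
  (∑-cong (subsets n) (λ A → trans
    (∑-cong (subsets n) (λ B → rearrange (f A * f B) a (κ _)))
    (∑-*ˡ (subsets n) a _)))
  (∑-*ˡ (subsets n) a _)
  where
  rearrange : ∀ u a v → u * (a * v) ≡ a * (u * v)
  rearrange = solve-∀

form-1 : ∀ {n} (f : Subset n → ℤ) → form (λ _ → 1ℤ) f ≡ total f * total f
form-1 {n} f = trans
  (∑-cong (subsets n) (λ A → ∑-cong (subsets n) (λ B → ℤ.*-identityʳ (f A * f B))))
  (sym (∑-product (subsets n) (subsets n) f f))

supported-cong : ∀ {n k} {f : Subset n → ℤ} → Supported n k f →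
  ∀ {x y} A → (∣ A ∣ ≡ k → x ≡ y) → f A * x ≡ f A * y
supported-cong {k = k} {f} supp {x} {y} A eq with ∣ A ∣ ℕ.≟ k
... | yes |A|≡k = cong (f A *_) (eq |A|≡k)
... | no  |A|≢k rewrite supp A |A|≢k = trans (ℤ.*-zeroˡ x) (sym (ℤ.*-zeroˡ y))

kernel-cong : ∀ {n k} {f : Subset n → ℤ} → Supported n k f → ∀ {x y} A B →
  (∣ A ∣ ≡ k → ∣ B ∣ ≡ k → x ≡ y) → f A * f B * x ≡ f A * f B * y
kernel-cong {n} {k} {f} supp {x} {y} A B eq = begin
  f A * f B * x    ≡⟨ ℤ.*-assoc (f A) (f B) x ⟩
  f A * (f B * x)  ≡⟨ supported-cong supp A (λ |A| → supported-cong supp B (λ |B| → eq |A| |B|)) ⟩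
  f A * (f B * y)  ≡⟨ ℤ.*-assoc (f A) (f B) y ⟨
  f A * f B * y    ∎
  where open ≡-Reasoning

form-cong : ∀ {n k} {κ μ : ℕ → ℤ} {f : Subset n → ℤ} → Supported n k f →
  (∀ i → i ℕ.≤ k → κ i ≡ μ i) → form κ f ≡ form μ f
form-cong {n} supp eq = ∑-cong (subsets n) (λ A → ∑-cong (subsets n) (λ B →
  kernel-cong supp A B (λ |A| _ → eq _ (subst (∣ A ∩ B ∣ ℕ.≤_) |A| (∣p∩q∣≤∣p∣ A B)))))

sameSize-⊆ : ∀ {n} (A B : Subset n) → ∣ A ∩ B ∣ ≡ ∣ A ∣ → ∣ A ∣ ≡ ∣ B ∣ → A ≡ B
sameSize-⊆ []          []          _ _ = refl
sameSize-⊆ (true  ∷ A) (true  ∷ B) p q =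
  cong (true ∷_) (sameSize-⊆ A B (ℕ.suc-injective p) (ℕ.suc-injective q))
sameSize-⊆ (false ∷ A) (false ∷ B) p q = cong (false ∷_) (sameSize-⊆ A B p q)
sameSize-⊆ (true  ∷ A) (false ∷ B) p q =
  contradiction (s≤s (∣p∩q∣≤∣p∣ A B)) (ℕ.<-irrefl p)
sameSize-⊆ (false ∷ A) (true  ∷ B) p q =
  contradiction (s≤s (∣p∩q∣≤∣q∣ A B)) (ℕ.<-irrefl (trans p q))

∑-single : ∀ {n} (A : Subset n) (f : Subset n → ℤ) → (∀ B → B ≢ A → f B ≡ 0ℤ) →
  total f ≡ f A
∑-single []          f zero-off = ∑-subsets-zero f
∑-single {suc n} (true  ∷ A) f zero-off = begin
  total f                                                ≡⟨ ∑-subsets-suc n f ⟩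
  total (f ∘ (false ∷_)) + total (f ∘ (true ∷_))
    ≡⟨ cong₂ _+_ (trans (∑-cong (subsets n) (λ B → zero-off _ λ ())) (∑-zero (subsets n)))
         (∑-single A _ (λ B B≢A → zero-off _ (B≢A ∘ cong tail))) ⟩
  0ℤ + f (true ∷ A)                                      ≡⟨ ℤ.+-identityˡ _ ⟩
  f (true ∷ A)                                           ∎
  where open ≡-Reasoning
∑-single {suc n} (false ∷ A) f zero-off = begin
  total f                                                ≡⟨ ∑-subsets-suc n f ⟩
  total (f ∘ (false ∷_)) + total (f ∘ (true ∷_))
    ≡⟨ cong₂ _+_ (∑-single A _ (λ B B≢A → zero-off _ (B≢A ∘ cong tail)))
         (trans (∑-cong (subsets n) (λ B → zero-off _ λ ())) (∑-zero (subsets n))) ⟩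
  f (false ∷ A) + 0ℤ                                     ≡⟨ ℤ.+-identityʳ _ ⟩
  f (false ∷ A)                                          ∎
  where open ≡-Reasoning

form-diagonal : ∀ {n k} {f : Subset n → ℤ} → Supported n k f →
  form [_≈ k ] f ≡ total (λ A → f A * f A)
form-diagonal {n} {k} {f} supp = ∑-cong (subsets n) λ A → trans
  (∑-single A _ (λ B B≢A → trans
    (kernel-cong supp A B (λ |A| |B| → ⟦⟧-no (_ ℕ.≟ k) (λ |A∩B| →
      B≢A (sym (sameSize-⊆ A B (trans |A∩B| (sym |A|)) (trans |A| (sym |B|)))))))
    (ℤ.*-zeroʳ (f A * f B))))
  (trans (kernel-cong supp A A (λ |A| _ →
            trans (cong [_≈ k ] (trans (cong ∣_∣ (∩-idem A)) |A|)) (⟦⟧-yes (k ℕ.≟ k) refl)))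
         (ℤ.*-identityʳ _))

gram : (n k : ℕ) → (ℕ → ℤ) → ℕ → ℤ
gram n k c i = pairSum n k i (λ t p q → [ t ≈ k ] * (c p * c q))

form-gram-nonneg : ∀ {n k} (c : ℕ → ℤ) {f : Subset n → ℤ} → Supported n k f →
  0ℤ ≤ form (gram n k c) f
form-gram-nonneg {n} {k} c {f} supp = subst (0ℤ ≤_) expand
  (∑-nonneg S (λ T → *-nonneg (⟦⟧-nonneg (∣ T ∣ ℕ.≟ k)) (square-nonneg (∑ S (u T)))))
  where
  open ≡-Reasoning
  S : List (Subset n)
  S = subsets n
  u : Subset n → Subset n → ℤ
  u T A = f A * c ∣ A ∩ T ∣
  rearrange : ∀ w a x b y → w * (a * x * (b * y)) ≡ a * b * (w * (x * y))
  rearrange = solve-∀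
  expand : ∑ S (λ T → [ ∣ T ∣ ≈ k ] * (∑ S (u T) * ∑ S (u T))) ≡ form (gram n k c) f
  expand = begin
    ∑ S (λ T → [ ∣ T ∣ ≈ k ] * (∑ S (u T) * ∑ S (u T)))
      ≡⟨ ∑-cong S (λ T → trans (cong ([ ∣ T ∣ ≈ k ] *_) (∑-product S S (u T) (u T)))
           (trans (sym (∑-*ˡ S [ ∣ T ∣ ≈ k ] _))
                  (∑-cong S (λ A → sym (∑-*ˡ S [ ∣ T ∣ ≈ k ] _))))) ⟩
    ∑ S (λ T → ∑ S (λ A → ∑ S (λ B → [ ∣ T ∣ ≈ k ] * (u T A * u T B))))
      ≡⟨ ∑-swap S S _ ⟩
    ∑ S (λ A → ∑ S (λ T → ∑ S (λ B → [ ∣ T ∣ ≈ k ] * (u T A * u T B))))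
      ≡⟨ ∑-cong S (λ A → ∑-swap S S _) ⟩
    ∑ S (λ A → ∑ S (λ B → ∑ S (λ T → [ ∣ T ∣ ≈ k ] * (u T A * u T B))))
      ≡⟨ ∑-cong S (λ A → ∑-cong S (λ B → trans
           (∑-cong S (λ T → rearrange [ ∣ T ∣ ≈ k ] (f A) _ (f B) _))
           (∑-*ˡ S (f A * f B) _))) ⟩
    ∑ S (λ A → ∑ S (λ B → f A * f B * ∑ S (λ T → [ ∣ T ∣ ≈ k ] * (c ∣ A ∩ T ∣ * c ∣ B ∩ T ∣))))
      ≡⟨ ∑-cong S (λ A → ∑-cong S (λ B → kernel-cong supp A B (λ |A| |B| →
           ∑-pair A B |A| |B| (λ t p q → [ t ≈ k ] * (c p * c q))))) ⟩
    form (gram n k c) f ∎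

⟨_,_,_,_,_⟩ : ℤ → ℤ → ℤ → ℤ → ℤ → ℕ → ℤ
⟨ c₀ , c₁ , c₂ , c₃ , c₄ ⟩ 0 = c₀
⟨ c₀ , c₁ , c₂ , c₃ , c₄ ⟩ 1 = c₁
⟨ c₀ , c₁ , c₂ , c₃ , c₄ ⟩ 2 = c₂
⟨ c₀ , c₁ , c₂ , c₃ , c₄ ⟩ 3 = c₃
⟨ c₀ , c₁ , c₂ , c₃ , c₄ ⟩ _ = c₄

-- For the indicator function of a vertex set this is twice the number of edges
-- inside it, since ordered pairs are counted.
edges : ∀ {n} → (Subset n → ℤ) → ℤ
edges = form [_≈ 0 ]

form-combination : ∀ {n k} {f : Subset n → ℤ} → Supported n k f → ∀ a b d →
  form (λ i → a * [ i ≈ k ] + (b * [ i ≈ 0 ] + d * 1ℤ)) f ≡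
  a * total (λ A → f A * f A) + (b * edges f + d * (total f * total f))
form-combination {n} {k} {f} supp a b d = begin
  form (λ i → a * [ i ≈ k ] + (b * [ i ≈ 0 ] + d * 1ℤ)) f
    ≡⟨ form-+ (λ i → a * [ i ≈ k ]) (λ i → b * [ i ≈ 0 ] + d * 1ℤ) f ⟩
  form (λ i → a * [ i ≈ k ]) f + form (λ i → b * [ i ≈ 0 ] + d * 1ℤ) f
    ≡⟨ cong₂ _+_ (form-* a [_≈ k ] f) (form-+ (λ i → b * [ i ≈ 0 ]) (λ i → d * 1ℤ) f) ⟩
  a * form [_≈ k ] f + (form (λ i → b * [ i ≈ 0 ]) f + form (λ i → d * 1ℤ) f)
    ≡⟨ cong₂ _+_ (cong (a *_) (form-diagonal supp))
         (cong₂ _+_ (form-* b [_≈ 0 ] f)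
           (trans (form-* d (λ _ → 1ℤ) f) (cong (d *_) (form-1 f)))) ⟩
  a * total (λ A → f A * f A) + (b * edges f + d * (total f * total f)) ∎
  where open ≡-Reasoning

spectral-inequality : ∀ {n k} (c₁ c₂ : ℕ → ℤ) (m a b d : ℤ) .{{_ : Positive m}} →
  (∀ i → i ℕ.≤ k → gram n k c₁ i + + 5 * gram n k c₂ i ≡
    m * (a * [ i ≈ k ] + (b * [ i ≈ 0 ] + d * 1ℤ))) →
  ∀ {f : Subset n → ℤ} → Supported n k f →
  0ℤ ≤ a * total (λ A → f A * f A) + (b * edges f + d * (total f * total f))
spectral-inequality {n} {k} c₁ c₂ m a b d identity {f} supp =
  ℤ.*-cancelˡ-≤-pos _ _ m (subst₂ _≤_ (sym (ℤ.*-zeroʳ m)) sum≡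
    (ℤ.+-mono-≤ (form-gram-nonneg c₁ supp)
                (*-nonneg {+ 5} (+≤+ z≤n) (form-gram-nonneg c₂ supp))))
  where
  open ≡-Reasoning
  κ₁ κ₂ μ : ℕ → ℤ
  κ₁ = gram n k c₁
  κ₂ = gram n k c₂
  μ i = a * [ i ≈ k ] + (b * [ i ≈ 0 ] + d * 1ℤ)
  sum≡ : form (gram n k c₁) f + + 5 * form (gram n k c₂) f ≡
    m * (a * total (λ A → f A * f A) + (b * edges f + d * (total f * total f)))
  sum≡ = begin
    form κ₁ f + + 5 * form κ₂ f
      ≡⟨ cong (_+_ (form κ₁ f)) (form-* (+ 5) κ₂ f) ⟨
    form κ₁ f + form (λ i → + 5 * κ₂ i) f
      ≡⟨ form-+ κ₁ (λ i → + 5 * κ₂ i) f ⟨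
    form (λ i → κ₁ i + + 5 * κ₂ i) f
      ≡⟨ form-cong {κ = λ i → κ₁ i + + 5 * κ₂ i} {μ = λ i → m * μ i} supp identity ⟩
    form (λ i → m * μ i) f
      ≡⟨ form-* m μ f ⟩
    m * form μ f
      ≡⟨ cong (m *_) (form-combination supp a b d) ⟩
    m * (a * total (λ A → f A * f A) + (b * edges f + d * (total f * total f))) ∎

-- 20 I + A - J/6, with A the adjacency matrix, has eigenvalues 0, 0, 30, 16, 21
-- on the eigenspaces V₀, …, V₄ of the Johnson scheme.  It equals P² + 5 Q² for
-- P, Q in the scheme with eigenvalues 0, 0, 5, 4, 4 and 0, 0, 1, 0, 1; c₁ and c₂
-- list the entries of 210 P and 210 Q by intersection size.
least-eigenvalue : ∀ {f : Subset 11 → ℤ} → Supported 11 4 f →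
  0ℤ ≤ + 120 * total (λ A → f A * f A) + (+ 6 * edges f + - 1ℤ * (total f * total f))
least-eigenvalue = spectral-inequality c₁ c₂ (+ 7350) (+ 120) (+ 6) (- 1ℤ) identity
  where
  c₁ c₂ : ℕ → ℤ
  c₁ = ⟨ + 20 , + 0 , - + 10 , - + 10 , + 840 ⟩
  c₂ = ⟨ + 11 , - + 5 , + 3 , - + 7 , + 133 ⟩
  identity : ∀ i → i ℕ.≤ 4 → gram 11 4 c₁ i + + 5 * gram 11 4 c₂ i ≡
    + 7350 * (+ 120 * [ i ≈ 4 ] + (+ 6 * [ i ≈ 0 ] + - 1ℤ * 1ℤ))
  identity 0 _ = refl
  identity 1 _ = refl
  identity 2 _ = refl
  identity 3 _ = refl
  identity 4 _ = refl
  identity (suc (suc (suc (suc (suc _))))) (s≤s (s≤s (s≤s (s≤s ()))))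

-- 10 I - A + (5/66) J has eigenvalues 0, 30, 0, 14, 9 and equals P² + 5 Q² with
-- eigenvalues 0, 5, 0, 3, 3 and 0, 1, 0, 1, 0; here c₁ and c₂ are 2310 P and 2310 Q.
second-eigenvalue : ∀ {f : Subset 11 → ℤ} → Supported 11 4 f →
  0ℤ ≤ + 660 * total (λ A → f A * f A) + (- + 66 * edges f + + 5 * (total f * total f))
second-eigenvalue = spectral-inequality c₁ c₂ (+ 80850) (+ 660) (- + 66) (+ 5) identity
  where
  c₁ c₂ : ℕ → ℤ
  c₁ = ⟨ - + 365 , + 20 , + 75 , - + 200 , + 6125 ⟩
  c₂ = ⟨ - + 128 , + 48 , - + 40 , + 70 , + 840 ⟩
  identity : ∀ i → i ℕ.≤ 4 → gram 11 4 c₁ i + + 5 * gram 11 4 c₂ i ≡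
    + 80850 * (+ 660 * [ i ≈ 4 ] + (- + 66 * [ i ≈ 0 ] + + 5 * 1ℤ))
  identity 0 _ = refl
  identity 1 _ = refl
  identity 2 _ = refl
  identity 3 _ = refl
  identity 4 _ = refl
  identity (suc (suc (suc (suc (suc _))))) (s≤s (s≤s (s≤s (s≤s ()))))

≤-by-difference : ∀ {a b d} → b - a ≡ d → 0ℤ ≤ d → a ≤ b
≤-by-difference eq 0≤d = ℤ.0≤i-j⇒j≤i (subst (0ℤ ≤_) (sym eq) 0≤d)

difference-nonneg : ∀ {a b} → a ≤ b → 0ℤ ≤ b - a
difference-nonneg = ℤ.i≤j⇒0≤j-i

+-nonneg : ∀ {a b} → 0ℤ ≤ a → 0ℤ ≤ b → 0ℤ ≤ a + b
+-nonneg = ℤ.+-mono-≤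

term≤total : ∀ {n} {f : Subset n → ℤ} → (∀ A → 0ℤ ≤ f A) → ∀ A → f A ≤ total f
term≤total {n} {f} f≥0 A = subst (_≤ total f) only-A (∑-mono (subsets n) bound)
  where
  _≟_ : (B C : Subset n) → Dec (B ≡ C)
  _≟_ = ≡-dec Bool._≟_
  only-A : total (λ B → ⟦ B ≟ A ⟧ * f B) ≡ f A
  only-A = trans
    (∑-single A _ (λ B B≢A → trans (cong (_* f B) (⟦⟧-no (B ≟ A) B≢A)) (ℤ.*-zeroˡ (f B))))
    (trans (cong (_* f A) (⟦⟧-yes (A ≟ A) refl)) (ℤ.*-identityˡ (f A)))
  bound : ∀ B → ⟦ B ≟ A ⟧ * f B ≤ f B
  bound B = ℤ.≤-trans (ℤ.*-monoʳ-≤-nonNeg (f B) {{nonNegative (f≥0 B)}} (⟦⟧≤1 (B ≟ A)))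
    (ℤ.≤-reflexive (ℤ.*-identityˡ (f B)))

∑-allFin-suc : ∀ c (f : Fin (suc c) → ℤ) →
  ∑ (allFin (suc c)) f ≡ f zero + ∑ (allFin c) (f ∘ suc)
∑-allFin-suc c f = cong (_+_ (f zero))
  (trans (cong (λ is → ∑ is f) (sym (map-tabulate id suc))) (∑-map suc (allFin c) f))

∑-fin-single : ∀ {c} (a : Fin c) (f : Fin c → ℤ) → (∀ i → i ≢ a → f i ≡ 0ℤ) →
  ∑ (allFin c) f ≡ f a
∑-fin-single {suc c} zero f zero-off = begin
  ∑ (allFin (suc c)) f                ≡⟨ ∑-allFin-suc c f ⟩
  f zero + ∑ (allFin c) (f ∘ suc)
    ≡⟨ cong (_+_ (f zero)) (trans (∑-cong (allFin c) (λ i → zero-off (suc i) λ ())) (∑-zero (allFin c))) ⟩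
  f zero + 0ℤ                         ≡⟨ ℤ.+-identityʳ _ ⟩
  f zero                              ∎
  where open ≡-Reasoning
∑-fin-single {suc c} (suc a) f zero-off = begin
  ∑ (allFin (suc c)) f                ≡⟨ ∑-allFin-suc c f ⟩
  f zero + ∑ (allFin c) (f ∘ suc)
    ≡⟨ cong₂ _+_ (zero-off zero λ ())
         (∑-fin-single a (f ∘ suc) (λ i i≢a → zero-off (suc i) (i≢a ∘ Fin.suc-injective))) ⟩
  0ℤ + f (suc a)                      ≡⟨ ℤ.+-identityˡ _ ⟩
  f (suc a)                           ∎
  where open ≡-Reasoning

term≤∑ : ∀ {c} {f : Fin c → ℤ} → (∀ i → 0ℤ ≤ f i) → ∀ i → f i ≤ ∑ (allFin c) f
term≤∑ {suc c} {f} f≥0 i = subst (f i ≤_) (sym (∑-allFin-suc c f)) (bound i)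
  where
  bound : ∀ i → f i ≤ f zero + ∑ (allFin c) (f ∘ suc)
  bound zero    = subst (_≤ f zero + ∑ (allFin c) (f ∘ suc)) (ℤ.+-identityʳ _)
    (ℤ.+-monoʳ-≤ (f zero) (∑-nonneg (allFin c) (f≥0 ∘ suc)))
  bound (suc i) = subst (_≤ f zero + ∑ (allFin c) (f ∘ suc)) (ℤ.+-identityˡ _)
    (ℤ.+-mono-≤ (f≥0 zero) (term≤∑ (f≥0 ∘ suc) i))

∑-ones : ∀ c → ∑ (allFin c) (λ _ → 1ℤ) ≡ + c
∑-ones zero    = refl
∑-ones (suc c) = trans (∑-allFin-suc c (λ _ → 1ℤ)) (cong (_+_ 1ℤ) (∑-ones c))

∑-filter : ∀ {P : V → Set} (P? : ∀ x → Dec (P x)) (xs : List V) (f : V → ℤ) →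
  ∑ (filter P? xs) f ≡ ∑ xs (λ x → if does (P? x) then f x else 0ℤ)
∑-filter P? []       f = refl
∑-filter P? (x ∷ xs) f with does (P? x)
... | true  = cong (_+_ (f x)) (∑-filter P? xs f)
... | false = trans (∑-filter P? xs f) (sym (ℤ.+-identityˡ _))

length-as-∑ : ∀ (xs : List V) → + length xs ≡ ∑ xs (λ _ → 1ℤ)
length-as-∑ []       = refl
length-as-∑ (x ∷ xs) = cong (_+_ 1ℤ) (length-as-∑ xs)

infix 8 ⟦_⟧∧_

⟦_⟧∧_ : ∀ {P : Set} → Dec P → Bool → ℤ
⟦ P? ⟧∧ b = if does P? then (if b then 1ℤ else 0ℤ) else 0ℤ

χ : ∀ {n} → ℕ → VSet n → Subset n → ℤ
χ k S A = ⟦ ∣ A ∣ ℕ.≟ k ⟧∧ S A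

card-as-total : ∀ n k (S : VSet n) → + card n k S ≡ total (χ k S)
card-as-total n k S = begin
  + card n k S                                        ≡⟨ length-as-∑ (filter in-S? (vertices n k)) ⟩
  ∑ (filter in-S? (vertices n k)) (λ _ → 1ℤ)          ≡⟨ ∑-filter in-S? (vertices n k) _ ⟩
  ∑ (vertices n k) (λ A → ⟦ in-S? A ⟧)                ≡⟨ ∑-filter (λ A → ∣ A ∣ ℕ.≟ k) (allSubsets n) _ ⟩
  ∑ (allSubsets n) (λ A → if does (∣ A ∣ ℕ.≟ k) then ⟦ in-S? A ⟧ else 0ℤ)
    ≡⟨ cong (λ As → ∑ As (λ A → if does (∣ A ∣ ℕ.≟ k) then ⟦ in-S? A ⟧ else 0ℤ)) (subsets≡allSubsets n) ⟨
  total (λ A → if does (∣ A ∣ ℕ.≟ k) then ⟦ in-S? A ⟧ else 0ℤ)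
    ≡⟨ ∑-cong (subsets n) (λ A → cong (λ x → if does (∣ A ∣ ℕ.≟ k) then x else 0ℤ) (simplify A)) ⟩
  total (χ k S)                                       ∎
  where
  open ≡-Reasoning
  in-S? : ∀ A → Dec (S A ≡ true)
  in-S? A = S A Bool.≟ true
  simplify : ∀ A → ⟦ in-S? A ⟧ ≡ (if S A then 1ℤ else 0ℤ)
  simplify A with S A
  ... | true  = refl
  ... | false = refl

χ-member : ∀ {n} k (S : VSet n) A → ∣ A ∣ ≡ k → S A ≡ true → χ k S A ≡ 1ℤ
χ-member k S A = go (∣ A ∣ ℕ.≟ k)
  where
  go : ∀ {P} (P? : Dec P) {b} → P → b ≡ true → ⟦ P? ⟧∧ b ≡ 1ℤ
  go (yes _) p refl = refl
  go (no ¬p) p _    = contradiction p ¬p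

χ-nonmember : ∀ {n} k (S : VSet n) A → ¬ (∣ A ∣ ≡ k × S A ≡ true) → χ k S A ≡ 0ℤ
χ-nonmember k S A = go (∣ A ∣ ℕ.≟ k) (S A)
  where
  go : ∀ {P} (P? : Dec P) b → ¬ (P × b ≡ true) → ⟦ P? ⟧∧ b ≡ 0ℤ
  go (yes p) true  ¬pb = contradiction (p , refl) ¬pb
  go (yes _) false _   = refl
  go (no _)  _     _   = refl

χ-supported : ∀ {n k} (S : VSet n) → Supported n k (χ k S)
χ-supported {k = k} S A |A|≢k = χ-nonmember k S A (|A|≢k ∘ proj₁)

χ-nonneg : ∀ {n} k (S : VSet n) A → 0ℤ ≤ χ k S A
χ-nonneg k S A = go (∣ A ∣ ℕ.≟ k) (S A)
  where
  go : ∀ {P} (P? : Dec P) b → 0ℤ ≤ ⟦ P? ⟧∧ b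
  go (yes _) true  = +≤+ z≤n
  go (yes _) false = +≤+ z≤n
  go (no _)  _     = +≤+ z≤n

χ-idem : ∀ {n} k (S : VSet n) A → χ k S A * χ k S A ≡ χ k S A
χ-idem k S A = go (∣ A ∣ ℕ.≟ k) (S A)
  where
  go : ∀ {P} (P? : Dec P) b → ⟦ P? ⟧∧ b * ⟦ P? ⟧∧ b ≡ ⟦ P? ⟧∧ b
  go (yes _) true  = refl
  go (yes _) false = refl
  go (no _)  _     = refl

χ-complement : ∀ {n} k (S : VSet n) A → χ k S A + χ k (not ∘ S) A ≡ [ ∣ A ∣ ≈ k ]
χ-complement k S A = go (∣ A ∣ ℕ.≟ k) (S A)
  where
  go : ∀ {P} (P? : Dec P) b → ⟦ P? ⟧∧ b + ⟦ P? ⟧∧ not b ≡ ⟦ P? ⟧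
  go (yes _) true  = refl
  go (yes _) false = refl
  go (no _)  _     = refl

∣∣≡0⇒Empty : ∀ {n} (A : Subset n) → ∣ A ∣ ≡ 0 → Empty A
∣∣≡0⇒Empty (false ∷ A) |A|≡0 (suc x , there x∈A) = ∣∣≡0⇒Empty A |A|≡0 (x , x∈A)

Empty⇒∣∣≡0 : ∀ {n} (A : Subset n) → Empty A → ∣ A ∣ ≡ 0
Empty⇒∣∣≡0 {n} A empty = trans (cong ∣_∣ (Empty-unique empty)) (∣⊥∣≡0 n)

edge-term≤edges : ∀ {n} {f : Subset n → ℤ} → (∀ A → 0ℤ ≤ f A) → ∀ A B →
  f A * f B * [ ∣ A ∩ B ∣ ≈ 0 ] ≤ edges f
edge-term≤edges {n} {f} f≥0 A B = ℤ.≤-trans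
  (term≤total (term≥0 A) B)
  (term≤total (λ C → ∑-nonneg (subsets n) (term≥0 C)) A)
  where
  term≥0 : ∀ C D → 0ℤ ≤ f C * f D * [ ∣ C ∩ D ∣ ≈ 0 ]
  term≥0 C D = *-nonneg (*-nonneg (f≥0 C) (f≥0 D)) (⟦⟧-nonneg (∣ C ∩ D ∣ ℕ.≟ 0))

-- The components of the graph without S

module Components {n k : ℕ} {S : VSet n} {c : ℕ} (components : HasComponents n k S c) where

  label : RemV n k S → Fin c
  label = proj₁ components

  label-reach : ∀ u v → label u ≡ label v ⇔ Reach n k S (proj₁ u) (proj₁ v)
  label-reach = proj₂ (proj₂ components)

  opaque
    remaining? : ∀ A → Dec (Remaining n k S A)
    remaining? A = (∣ A ∣ ℕ.≟ k) ×-dec (S A Bool.≟ false)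

  classify : Fin c → ∀ A → Dec (Remaining n k S A) → ℤ
  classify i A (yes r) = ⟦ label (A , r) Fin.≟ i ⟧
  classify i A (no _)  = 0ℤ

  part : Fin c → Subset n → ℤ
  part i A = classify i A (remaining? A)

  part-remaining : ∀ i {A} (r : Remaining n k S A) → part i A ≡ ⟦ label (A , r) Fin.≟ i ⟧
  part-remaining i {A} r with remaining? A
  ... | yes r′ = cong (λ j → ⟦ j Fin.≟ i ⟧) (Equivalence.from (label-reach (A , r′) (A , r)) (here r))
  ... | no ¬r  = contradiction r ¬r

  part-removed : ∀ i {A} → ¬ Remaining n k S A → part i A ≡ 0ℤ
  part-removed i {A} ¬r with remaining? A
  ... | yes r = contradiction r ¬r
  ... | no _  = refl

  part-supported : ∀ i → Supported n k (part i)
  part-supported i A |A|≢k = part-removed i {A} (|A|≢k ∘ proj₁)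

  part-nonneg : ∀ i A → 0ℤ ≤ part i A
  part-nonneg i A with remaining? A
  ... | yes r = ⟦⟧-nonneg (label (A , r) Fin.≟ i)
  ... | no _  = ℤ.≤-refl

  part≤1 : ∀ i A → part i A ≤ 1ℤ
  part≤1 i A with remaining? A
  ... | yes r = ⟦⟧≤1 (label (A , r) Fin.≟ i)
  ... | no _  = +≤+ z≤n

  part-idem : ∀ i A → part i A * part i A ≡ part i A
  part-idem i A with remaining? A
  ... | yes r = ⟦⟧-idem (label (A , r) Fin.≟ i)
  ... | no _  = refl

  rest : Subset n → ℤ
  rest = χ k (not ∘ S)

  rest-remaining : ∀ {A} → Remaining n k S A → rest A ≡ 1ℤ
  rest-remaining {A} (|A|≡k , SA) = χ-member k (not ∘ S) A |A|≡k (cong not SA)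

  rest-removed : ∀ {A} → ¬ Remaining n k S A → rest A ≡ 0ℤ
  rest-removed {A} ¬r = χ-nonmember k (not ∘ S) A (λ (|A|≡k , eq) →
    ¬r (|A|≡k , trans (sym (not-involutive (S A))) (cong not eq)))

  ∑-label : ∀ j (h : Fin c → ℤ) → ∑ (allFin c) (λ i → ⟦ j Fin.≟ i ⟧ * h i) ≡ h j
  ∑-label j h = trans
    (∑-fin-single j _ (λ i i≢j → trans (cong (_* h i) (⟦⟧-no (j Fin.≟ i) (i≢j ∘ sym))) (ℤ.*-zeroˡ (h i))))
    (trans (cong (_* h j) (⟦⟧-yes (j Fin.≟ j) refl)) (ℤ.*-identityˡ (h j)))

  ∑-part : ∀ A → ∑ (allFin c) (λ i → part i A) ≡ rest A
  ∑-part A with remaining? A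
  ... | no ¬r = trans (∑-zero (allFin c)) (sym (rest-removed ¬r))
  ... | yes r = trans (∑-cong (allFin c) (λ i → sym (ℤ.*-identityʳ _)))
    (trans (∑-label (label (A , r)) (λ _ → 1ℤ)) (sym (rest-remaining r)))

  adjacent-labels : ∀ {A B} (r : Remaining n k S A) (r′ : Remaining n k S B) →
    ∣ A ∩ B ∣ ≡ 0 → label (A , r) ≡ label (B , r′)
  adjacent-labels {A} {B} r r′ disjoint =
    Equivalence.from (label-reach (A , r) (B , r′)) (step r (∣∣≡0⇒Empty (A ∩ B) disjoint) (here r′))

  ∑-part-edge : ∀ A B →
    ∑ (allFin c) (λ i → part i A * part i B * [ ∣ A ∩ B ∣ ≈ 0 ]) ≡ rest A * rest B * [ ∣ A ∩ B ∣ ≈ 0 ]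
  ∑-part-edge A B with remaining? A | remaining? B
  ... | no ¬r | B? = trans (∑-zero′ (λ i → cong (_* e) (ℤ.*-zeroˡ (classify i B B?))))
    (sym (cong (λ x → x * rest B * e) (rest-removed ¬r)))
    where
    e = [ ∣ A ∩ B ∣ ≈ 0 ]
    ∑-zero′ : ∀ {f : Fin c → ℤ} → (∀ i → f i ≡ 0ℤ) → ∑ (allFin c) f ≡ 0ℤ
    ∑-zero′ eq = trans (∑-cong (allFin c) eq) (∑-zero (allFin c))
  ... | yes r | no ¬r = trans (trans (∑-cong (allFin c) (λ i → cong (_* e) (ℤ.*-zeroʳ ⟦ label (A , r) Fin.≟ i ⟧)))
                                     (∑-zero (allFin c)))
    (sym (cong (_* e) (trans (cong (rest A *_) (rest-removed {B} ¬r)) (ℤ.*-zeroʳ (rest A)))))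
    where
    e = [ ∣ A ∩ B ∣ ≈ 0 ]
  ... | yes r | yes r′ = trans
    (∑-cong (allFin c) (λ i → ℤ.*-assoc ⟦ label (A , r) Fin.≟ i ⟧ ⟦ label (B , r′) Fin.≟ i ⟧ e))
    (trans (∑-label (label (A , r)) (λ i → ⟦ label (B , r′) Fin.≟ i ⟧ * e))
    (trans (same (∣ A ∩ B ∣ ℕ.≟ 0)) (sym (cong₂ (λ x y → x * y * e) (rest-remaining r) (rest-remaining r′)))))
    where
    e = [ ∣ A ∩ B ∣ ≈ 0 ]
    L? = label (B , r′) Fin.≟ label (A , r)
    same : (E? : Dec (∣ A ∩ B ∣ ≡ 0)) → ⟦ L? ⟧ * ⟦ E? ⟧ ≡ 1ℤ * 1ℤ * ⟦ E? ⟧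
    same (no _)         = ℤ.*-zeroʳ ⟦ L? ⟧
    same (yes disjoint) = cong (_* 1ℤ) (⟦⟧-yes L? (sym (adjacent-labels r r′ disjoint)))

  ∑-sizes : ∑ (allFin c) (λ i → total (part i)) ≡ total rest
  ∑-sizes = trans (∑-swap (allFin c) (subsets n) part) (∑-cong (subsets n) ∑-part)

  ∑-edges : ∑ (allFin c) (λ i → edges (part i)) ≡ edges rest
  ∑-edges = trans (∑-swap (allFin c) (subsets n) _)
    (∑-cong (subsets n) (λ A → trans (∑-swap (allFin c) (subsets n) _)
      (∑-cong (subsets n) (∑-part-edge A))))

  representative : ∀ i → ∃ λ (u : RemV n k S) → label u ≡ i
  representative i with proj₁ (proj₂ components) i
  ... | u , fibre = u , fibre refl

  part-nonempty : ∀ i → 1ℤ ≤ total (part i)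
  part-nonempty i with representative i
  ... | (A , r) , label≡i = subst (_≤ total (part i))
    (trans (part-remaining i r) (⟦⟧-yes (label (A , r) Fin.≟ i) label≡i))
    (term≤total (part-nonneg i) A)

  other-label : IsVertexCut n k S → ∀ i → ∃ λ (u : RemV n k S) → label u ≢ i
  other-label (A , B , r , r′ , ¬reach) i with label (A , r) Fin.≟ i
  ... | no  A∉i = (A , r) , A∉i
  ... | yes A∈i = (B , r′) , λ B∈i →
    ¬reach (Equivalence.to (label-reach (A , r) (B , r′)) (trans A∈i (sym B∈i)))

  part-avoids-neighbours : ∀ i (u : RemV n k S) → label u ≢ i → ∀ A →
    part i A + [ ∣ A ∣ ≈ k ] * [ ∣ proj₁ u ∩ A ∣ ≈ 0 ] ≤ [ ∣ A ∣ ≈ k ]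
  part-avoids-neighbours i (U , r) U∉i A =
    go (∣ A ∣ ℕ.≟ k) (∣ U ∩ A ∣ ℕ.≟ 0)
    where
    A∉i : ∣ A ∣ ≡ k → ∣ U ∩ A ∣ ≡ 0 → part i A ≡ 0ℤ
    A∉i |A|≡k disjoint with S A Bool.≟ false
    ... | no  A∈S = part-removed i (A∈S ∘ proj₂)
    ... | yes A∉S = trans (part-remaining i (|A|≡k , A∉S))
      (⟦⟧-no (label (A , |A|≡k , A∉S) Fin.≟ i)
        (U∉i ∘ trans (adjacent-labels r (|A|≡k , A∉S) disjoint)))
    go : (P? : Dec (∣ A ∣ ≡ k)) (Q? : Dec (∣ U ∩ A ∣ ≡ 0)) → part i A + ⟦ P? ⟧ * ⟦ Q? ⟧ ≤ ⟦ P? ⟧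
    go (no |A|≢k)  Q?         = ℤ.≤-reflexive (cong₂ _+_ (part-supported i A |A|≢k) (ℤ.*-zeroˡ ⟦ Q? ⟧))
    go (yes _)     (no _)     = subst (_≤ 1ℤ) (sym (ℤ.+-identityʳ (part i A))) (part≤1 i A)
    go (yes |A|≡k) (yes disj) = ℤ.≤-reflexive (cong (_+ 1ℤ) (A∉i |A|≡k disj))

size-ext : ∀ {n} {f : Subset n → ℤ} → (∀ A → f A * f A ≡ f A) →
  total (λ A → f A * f A) ≡ total f
size-ext {n} = ∑-cong (subsets n)

edges-lower : ∀ {f : Subset 11 → ℤ} → Supported 11 4 f → (∀ A → f A * f A ≡ f A) →
  total f * (total f - + 120) ≤ + 6 * edges f
edges-lower {f} supp idem = ≤-by-difference (difference (total f) (edges f))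
  (subst (λ m → 0ℤ ≤ + 120 * m + (+ 6 * edges f + - 1ℤ * (total f * total f)))
    (size-ext idem) (least-eigenvalue {f} supp))
  where
  difference : ∀ m e → + 6 * e - m * (m - + 120) ≡ + 120 * m + (+ 6 * e + - 1ℤ * (m * m))
  difference = solve-∀

edges-upper : ∀ {f : Subset 11 → ℤ} → Supported 11 4 f → (∀ A → f A * f A ≡ f A) →
  + 66 * edges f ≤ + 660 * total f + + 5 * (total f * total f)
edges-upper {f} supp idem = ≤-by-difference (difference (total f) (edges f))
  (subst (λ m → 0ℤ ≤ + 660 * m + (- + 66 * edges f + + 5 * (total f * total f)))
    (size-ext idem) (second-eigenvalue {f} supp))
  where
  difference : ∀ m e → + 660 * m + + 5 * (m * m) - + 66 * e ≡
    + 660 * m + (- + 66 * e + + 5 * (m * m))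
  difference = solve-∀

edges-trivial : ∀ {f : Subset 11 → ℤ} → Supported 11 4 f → (∀ A → f A * f A ≡ f A) →
  (∀ A → 0ℤ ≤ f A) → edges f ≤ total f * total f - total f
edges-trivial {f} supp idem f≥0 = ≤-by-difference (difference (total f) (edges f))
  (subst (λ m → 0ℤ ≤ - 1ℤ * m + (- 1ℤ * edges f + 1ℤ * (total f * total f)))
    (size-ext idem) (subst (0ℤ ≤_) (form-combination supp (- 1ℤ) (- 1ℤ) 1ℤ)
      (∑-nonneg (subsets 11) (λ A → ∑-nonneg (subsets 11) (λ B →
        *-nonneg (*-nonneg (f≥0 A) (f≥0 B)) (nonneg (∣ A ∩ B ∣)))))))
  where
  nonneg : ∀ i → 0ℤ ≤ - 1ℤ * [ i ≈ 4 ] + (- 1ℤ * [ i ≈ 0 ] + 1ℤ * 1ℤ)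
  nonneg 0 = +≤+ z≤n
  nonneg 1 = +≤+ z≤n
  nonneg 2 = +≤+ z≤n
  nonneg 3 = +≤+ z≤n
  nonneg 4 = +≤+ z≤n
  nonneg (suc (suc (suc (suc (suc i))))) = +≤+ z≤n
  difference : ∀ m e → m * m - m - e ≡ - 1ℤ * m + (- 1ℤ * e + 1ℤ * (m * m))
  difference = solve-∀

total-vertices : total {11} (λ A → [ ∣ A ∣ ≈ 4 ]) ≡ + 330
total-vertices = ∑-pair U U refl refl (λ t _ _ → [ t ≈ 4 ])
  where
  U : Subset 11
  U = true ∷ true ∷ true ∷ true ∷ false ∷ false ∷ false ∷ false ∷ false ∷ false ∷ false ∷ []

total-neighbours : ∀ (U : Subset 11) → ∣ U ∣ ≡ 4 →
  total (λ A → [ ∣ A ∣ ≈ 4 ] * [ ∣ U ∩ A ∣ ≈ 0 ]) ≡ + 35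
total-neighbours U |U|≡4 = trans
  (∑-pair U U |U|≡4 |U|≡4 (λ t p _ → [ t ≈ 4 ] * [ p ≈ 0 ]))
  (cong (λ i → pairSum 11 4 i (λ t p _ → [ t ≈ 4 ] * [ p ≈ 0 ]))
    (trans (cong ∣_∣ (∩-idem U)) |U|≡4))

-- For x ≥ 11 the claim amounts to 6 x² - 1859 x + 7315 ≤ 0, which follows from
-- (x - 11) (294 - x) ≥ 0.
component-bound : ∀ x t e → 0ℤ ≤ x → x ≤ + 294 → 0ℤ ≤ t → + 7 * x ≤ + 11 * t →
  e ≤ (x + 1ℤ) * (x + 1ℤ) - (x + 1ℤ) →
  + 66 * e ≤ + 660 * (x + 1ℤ) + + 5 * ((x + 1ℤ) * (x + 1ℤ)) →
  + 66 * e + x ≤ + 7 * x * (+ 120 + t)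
component-bound x t e 0≤x x≤294 0≤t 7x≤11t e≤trivial e≤upper with x ℤ.≤? + 10
... | yes x≤10 = ≤-by-difference (difference x t e)
  (+-nonneg (*-nonneg {+ 66} (+≤+ z≤n) (difference-nonneg e≤trivial))
    (*-nonneg 0≤x (+-nonneg (+-nonneg {+ 113} (+≤+ z≤n)
      (*-nonneg {+ 66} (+≤+ z≤n) (difference-nonneg x≤10))) (*-nonneg {+ 7} (+≤+ z≤n) 0≤t))))
  where
  difference : ∀ x t e → + 7 * x * (+ 120 + t) - (+ 66 * e + x) ≡
    + 66 * ((x + 1ℤ) * (x + 1ℤ) - (x + 1ℤ) - e) +
    x * (+ 113 + + 66 * (+ 10 - x) + + 7 * t)
  difference = solve-∀
... | no  x≰10 = ℤ.*-cancelˡ-≤-pos _ _ (+ 11) (≤-by-difference (difference x t e)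
  (+-nonneg (+-nonneg (*-nonneg {+ 11} (+≤+ z≤n) (difference-nonneg e≤upper))
    (*-nonneg (*-nonneg {+ 7} (+≤+ z≤n) 0≤x) (difference-nonneg 7x≤11t)))
    (+-nonneg (*-nonneg {+ 6} (+≤+ z≤n) (*-nonneg (difference-nonneg 11≤x) (difference-nonneg x≤294)))
      (+-nonneg (*-nonneg {+ 29} (+≤+ z≤n) 0≤x) (+≤+ z≤n)))))
  where
  11≤x : + 11 ≤ x
  11≤x = ℤ.i<j⇒suc[i]≤j (ℤ.≰⇒> x≰10)
  difference : ∀ x t e → + 11 * (+ 7 * x * (+ 120 + t)) - + 11 * (+ 66 * e + x) ≡
    + 11 * (+ 660 * (x + 1ℤ) + + 5 * ((x + 1ℤ) * (x + 1ℤ)) - + 66 * e) +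
    + 7 * x * (+ 11 * t - + 7 * x) +
    (+ 6 * ((x - + 11) * (+ 294 - x)) + (+ 29 * x + + 12089))
  difference = solve-∀

module Extremal {S : VSet 11} {c : ℕ} (cut : IsVertexCut 11 4 S)
  (components : HasComponents 11 4 S c) (4s≤7c : 4 ℕ.* card 11 4 S ℕ.≤ 7 ℕ.* c) where

  open Components components

  s N t X E : ℤ
  s = + card 11 4 S
  N = total rest
  t = N - + 120
  X = N - + c
  E = edges rest

  excess : Fin c → ℤ
  excess i = total (part i) - 1ℤ

  s+N≡330 : s + N ≡ + 330
  s+N≡330 = begin
    s + N                                               ≡⟨ cong (_+ N) (card-as-total 11 4 S) ⟩
    total (χ 4 S) + total rest                          ≡⟨ ∑-+ (subsets 11) (χ 4 S) rest ⟨
    total (λ A → χ 4 S A + rest A)                      ≡⟨ ∑-cong (subsets 11) (χ-complement 4 S) ⟩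
    total {11} (λ A → [ ∣ A ∣ ≈ 4 ])                    ≡⟨ total-vertices ⟩
    + 330                                               ∎
    where open ≡-Reasoning

  7X≤11t : + 7 * X ≤ + 11 * t
  7X≤11t = ≤-by-difference (difference N (+ c))
    (subst (λ x → 0ℤ ≤ + 7 * + c - + 4 * (x - N)) s+N≡330
      (subst (λ x → 0ℤ ≤ + 7 * + c - + 4 * x) (cancel s N) 0≤7c-4s))
    where
    difference : ∀ N c → + 11 * (N - + 120) - + 7 * (N - c) ≡ + 7 * c - + 4 * (+ 330 - N)
    difference = solve-∀
    cancel : ∀ s N → s ≡ s + N - N
    cancel = solve-∀
    0≤7c-4s : 0ℤ ≤ + 7 * + c - + 4 * s
    0≤7c-4s = difference-nonneg (subst₂ _≤_ (ℤ.pos-* 4 (card 11 4 S)) (ℤ.pos-* 7 c) (+≤+ 4s≤7c))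

  ∑-excess : ∑ (allFin c) excess ≡ X
  ∑-excess = trans (∑-+ (allFin c) (λ i → total (part i)) (λ _ → - 1ℤ)) (cong₂ _+_ ∑-sizes
    (trans (∑-*ˡ (allFin c) (- 1ℤ) (λ _ → 1ℤ)) (trans (cong (- 1ℤ *_) (∑-ones c)) (ℤ.-1*i≡-i (+ c)))))

  excess-nonneg : ∀ i → 0ℤ ≤ excess i
  excess-nonneg i = difference-nonneg (part-nonempty i)

  excess≤X : ∀ i → excess i ≤ X
  excess≤X i = subst (excess i ≤_) ∑-excess (term≤∑ excess-nonneg i)

  0≤X : 0ℤ ≤ X
  0≤X = subst (0ℤ ≤_) ∑-excess (∑-nonneg (allFin c) excess-nonneg)

  0≤t : 0ℤ ≤ t
  0≤t = ℤ.*-cancelˡ-≤-pos 0ℤ t (+ 11)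
    (ℤ.≤-trans (*-nonneg {+ 7} (+≤+ z≤n) 0≤X) 7X≤11t)

  excess≤294 : ∀ i → excess i ≤ + 294
  excess≤294 i with other-label cut i
  ... | (U , r) , U∉i = ≤-by-difference (difference (total (part i)))
    (difference-nonneg (subst₂ (λ x y → total (part i) + x ≤ y) (total-neighbours U (proj₁ r)) total-vertices
      (subst (_≤ total {11} (λ A → [ ∣ A ∣ ≈ 4 ]))
        (∑-+ (subsets 11) (part i) (λ A → [ ∣ A ∣ ≈ 4 ] * [ ∣ U ∩ A ∣ ≈ 0 ]))
        (∑-mono (subsets 11) (part-avoids-neighbours i (U , r) U∉i)))))
    where
    difference : ∀ m → + 294 - (m - 1ℤ) ≡ + 330 - (m + + 35)
    difference = solve-∀

  bound : ∀ i → + 66 * edges (part i) + excess i ≤ + 7 * excess i * N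
  bound i = subst (λ x → + 66 * edges (part i) + excess i ≤ + 7 * excess i * x) (cancel (+ 120) N)
    (component-bound (excess i) t (edges (part i)) (excess-nonneg i) (excess≤294 i) 0≤t
      (ℤ.≤-trans (ℤ.*-monoˡ-≤-nonNeg (+ 7) (excess≤X i)) 7X≤11t)
      (subst (λ m → edges (part i) ≤ m * m - m) size≡
        (edges-trivial {part i} (part-supported i) (part-idem i) (part-nonneg i)))
      (subst (λ m → + 66 * edges (part i) ≤ + 660 * m + + 5 * (m * m)) size≡
        (edges-upper {part i} (part-supported i) (part-idem i))))
    where
    cancel : ∀ a b → a + (b - a) ≡ b
    cancel = solve-∀
    size≡ : total (part i) ≡ excess i + 1ℤ
    size≡ = sym (trans (ℤ.+-assoc (total (part i)) (- 1ℤ) 1ℤ) (ℤ.+-identityʳ _))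

  ∑-bound : + 66 * E + X ≤ + 7 * X * N
  ∑-bound = subst₂ _≤_
    (trans (∑-+ (allFin c) (λ i → + 66 * edges (part i)) excess)
      (cong₂ _+_ (trans (∑-*ˡ (allFin c) (+ 66) (λ i → edges (part i))) (cong (+ 66 *_) ∑-edges)) ∑-excess))
    (trans (trans (∑-cong (allFin c) (λ i → rearrange (excess i) N)) (∑-*ˡ (allFin c) (+ 7 * N) excess))
      (trans (cong (+ 7 * N *_) ∑-excess) (sym (rearrange X N))))
    (∑-mono (allFin c) bound)
    where
    rearrange : ∀ x N → + 7 * x * N ≡ + 7 * N * x
    rearrange = solve-∀

  Nt≤6E : N * t ≤ + 6 * E
  Nt≤6E = edges-lower {rest} (χ-supported (not ∘ S)) (χ-idem 4 (not ∘ S))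

  0≤N : 0ℤ ≤ N
  0≤N = ∑-nonneg (subsets 11) (χ-nonneg 4 (not ∘ S))

  X≡0 : X ≡ 0ℤ
  X≡0 = ℤ.≤-antisym (≤-by-difference (difference X t N E)
    (+-nonneg (+-nonneg (difference-nonneg ∑-bound)
      (*-nonneg {+ 11} (+≤+ z≤n) (difference-nonneg Nt≤6E)))
      (*-nonneg 0≤N (difference-nonneg 7X≤11t)))) 0≤X
    where
    difference : ∀ X t N E → 0ℤ - X ≡
      (+ 7 * X * N - (+ 66 * E + X)) + + 11 * (+ 6 * E - N * t) + N * (+ 11 * t - + 7 * X)
    difference = solve-∀

  E≤0 : E ≤ 0ℤ
  E≤0 = ℤ.*-cancelˡ-≤-pos E 0ℤ (+ 66) (subst₂ _≤_
    (trans (cong (_+_ (+ 66 * E)) X≡0) (ℤ.+-identityʳ _))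
    (trans (cong (λ x → + 7 * x * N) X≡0) (ℤ.*-zeroˡ N)) ∑-bound)

  t≡0 : t ≡ 0ℤ
  t≡0 = ℤ.≤-antisym (ℤ.*-cancelˡ-≤-pos t 0ℤ (+ 120) (≤-by-difference (difference N E)
    (+-nonneg (+-nonneg (square-nonneg t) (difference-nonneg Nt≤6E))
      (*-nonneg {+ 6} (+≤+ z≤n) (difference-nonneg E≤0))))) 0≤t
    where
    difference : ∀ N E → + 120 * 0ℤ - + 120 * (N - + 120) ≡
      (N - + 120) * (N - + 120) + (+ 6 * E - N * (N - + 120)) + + 6 * (0ℤ - E)
    difference = solve-∀

  N≡120 : N ≡ + 120
  N≡120 = ℤ.i-j≡0⇒i≡j N (+ 120) t≡0

  c≡120 : c ≡ 120
  c≡120 = ℤ.+-injective (trans (sym (ℤ.i-j≡0⇒i≡j N (+ c) X≡0)) N≡120)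

  card≡210 : card 11 4 S ≡ 210
  card≡210 = ℤ.+-injective (trans (cancel s N) (cong₂ _-_ s+N≡330 N≡120))
    where
    cancel : ∀ s N → s ≡ s + N - N
    cancel = solve-∀

  rest-independent : IsIndependent 11 4 (not ∘ S)
  rest-independent A B |A| |B| A∉S B∉S adjacent = contradiction (ℤ.≤-trans 1≤E E≤0) λ { (+≤+ ()) }
    where
    1≤E : 1ℤ ≤ E
    1≤E = subst (_≤ E)
      (cong₂ _*_ (cong₂ _*_ (χ-member 4 (not ∘ S) A |A| A∉S) (χ-member 4 (not ∘ S) B |B| B∉S))
        (⟦⟧-yes (∣ A ∩ B ∣ ℕ.≟ 0) (Empty⇒∣∣≡0 (A ∩ B) adjacent)))
      (edge-term≤edges (χ-nonneg 4 (not ∘ S)) A B)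

independent-card : ∀ (J : VSet 11) → IsIndependent 11 4 J → card 11 4 J ℕ.≤ 120
independent-card J independent = ℤ.drop‿+≤+ (subst (_≤ + 120) (sym (card-as-total 11 4 J)) m≤120)
  where
  m : ℤ
  m = total (χ 4 J)
  E≡0 : edges (χ 4 J) ≡ 0ℤ
  E≡0 = trans (∑-cong (subsets 11) (λ A → trans (∑-cong (subsets 11) (no-edge A)) (∑-zero (subsets 11))))
    (∑-zero (subsets 11))
    where
    J? : ∀ A → Dec (∣ A ∣ ≡ 4 × J A ≡ true)
    J? A = (∣ A ∣ ℕ.≟ 4) ×-dec (J A Bool.≟ true)
    e : Subset 11 → Subset 11 → ℤ
    e A B = [ ∣ A ∩ B ∣ ≈ 0 ]
    no-edge : ∀ A B → χ 4 J A * χ 4 J B * e A B ≡ 0ℤ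
    no-edge A B with J? A | J? B
    ... | no A∉J | _      = cong (λ x → x * χ 4 J B * e A B) (χ-nonmember 4 J A A∉J)
    ... | yes _  | no B∉J = trans (cong (λ x → χ 4 J A * x * e A B) (χ-nonmember 4 J B B∉J))
      (cong (_* e A B) (ℤ.*-zeroʳ (χ 4 J A)))
    ... | yes (|A| , JA) | yes (|B| , JB) = trans (cong (χ 4 J A * χ 4 J B *_)
      (⟦⟧-no (∣ A ∩ B ∣ ℕ.≟ 0) (independent A B |A| |B| JA JB ∘ ∣∣≡0⇒Empty (A ∩ B))))
      (ℤ.*-zeroʳ (χ 4 J A * χ 4 J B))
  m[m-120]≤0 : m * (m - + 120) ≤ 0ℤ
  m[m-120]≤0 = subst (m * (m - + 120) ≤_) (cong (+ 6 *_) E≡0)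
    (edges-lower {χ 4 J} (χ-supported J) (χ-idem 4 J))
  m≤120 : m ≤ + 120
  m≤120 with m ℤ.≤? + 120
  ... | yes m≤120 = m≤120
  ... | no  m≰120 = contradiction (ℤ.≤-trans 121≤m m≤0) λ { (+≤+ ()) }
    where
    121≤m : + 121 ≤ m
    121≤m = ℤ.i<j⇒suc[i]≤j (ℤ.≰⇒> m≰120)
    0≤m : 0ℤ ≤ m
    0≤m = ℤ.≤-trans (+≤+ z≤n) 121≤m
    difference : ∀ m → 0ℤ - m ≡ (0ℤ - m * (m - + 120)) + m * (m - + 121)
    difference = solve-∀
    m≤0 : m ≤ 0ℤ
    m≤0 = ≤-by-difference (difference m)
      (+-nonneg (difference-nonneg m[m-120]≤0) (*-nonneg 0≤m (difference-nonneg 121≤m)))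

-- The complement of a star attains the bound

binomial : ℕ → ℕ → ℕ
binomial zero    zero    = 1
binomial zero    (suc k) = 0
binomial (suc n) zero    = binomial n zero
binomial (suc n) (suc k) = binomial n k ℕ.+ binomial n (suc k)

rank : ∀ {n} k (A : Subset n) → ∣ A ∣ ≡ k → Fin (binomial n k)
rank zero    []          _     = zero
rank zero    (false ∷ A) |A|≡k = rank zero A |A|≡k
rank (suc k) (true  ∷ A) |A|≡k = rank k A (ℕ.suc-injective |A|≡k) ↑ˡ _
rank (suc k) (false ∷ A) |A|≡k = _ ↑ʳ rank (suc k) A |A|≡k

↑ˡ≢↑ʳ : ∀ {m n} (i : Fin m) (j : Fin n) → i ↑ˡ n ≢ m ↑ʳ j
↑ˡ≢↑ʳ {m} {n} i j eq with trans (sym (Fin.splitAt-↑ˡ m i n)) (trans (cong (Fin.splitAt m) eq) (Fin.splitAt-↑ʳ m n j))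
... | ()

rank-injective : ∀ {n} k (A B : Subset n) (p : ∣ A ∣ ≡ k) (q : ∣ B ∣ ≡ k) →
  rank k A p ≡ rank k B q → A ≡ B
rank-injective zero    []          []          p q eq = refl
rank-injective zero    (false ∷ A) (false ∷ B) p q eq = cong (false ∷_) (rank-injective zero A B p q eq)
rank-injective (suc k) (true  ∷ A) (true  ∷ B) p q eq =
  cong (true ∷_) (rank-injective k A B _ _ (Fin.↑ˡ-injective _ _ _ eq))
rank-injective (suc k) (true  ∷ A) (false ∷ B) p q eq = contradiction eq (↑ˡ≢↑ʳ _ _)
rank-injective (suc k) (false ∷ A) (true  ∷ B) p q eq = contradiction (sym eq) (↑ˡ≢↑ʳ _ _)
rank-injective (suc k) (false ∷ A) (false ∷ B) p q eq =
  cong (false ∷_) (rank-injective (suc k) A B p q (Fin.↑ʳ-injective _ _ _ eq))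

rank-surjective : ∀ n k (i : Fin (binomial n k)) → ∃ λ (A : Subset n) → Σ (∣ A ∣ ≡ k) λ p → rank k A p ≡ i
rank-surjective zero    zero    zero = [] , refl , refl
rank-surjective (suc n) zero    i with rank-surjective n zero i
... | A , p , eq = false ∷ A , p , eq
rank-surjective (suc n) (suc k) i with Fin.splitAt (binomial n k) i in split
... | inj₁ j with rank-surjective n k j
...   | A , p , eq = true ∷ A , cong suc p ,
  trans (cong (_↑ˡ binomial n (suc k)) (trans (cong (rank k A) (ℕ.≡-irrelevant _ _)) eq)) (Fin.splitAt⁻¹-↑ˡ split)
rank-surjective (suc n) (suc k) i | inj₂ j with rank-surjective n (suc k) j
...   | A , p , eq = false ∷ A , p , trans (cong (binomial n k ↑ʳ_) eq) (Fin.splitAt⁻¹-↑ʳ split)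

coStar : ∀ {n} → VSet (suc n)
coStar A = not (head A)

remaining-head : ∀ {n k} (A : Subset (suc n)) → Remaining (suc n) k coStar A → head A ≡ true
remaining-head (true ∷ _) _ = refl

reach-remaining : ∀ {n k} {S : VSet n} {A B} → Reach n k S A B → Remaining n k S A
reach-remaining (here r)     = r
reach-remaining (step r _ _) = r

heads-meet : ∀ {n} (A B : Subset (suc n)) → head A ≡ true → head B ≡ true → ¬ Adj A B
heads-meet (true ∷ A) (true ∷ B) refl refl adjacent = adjacent (zero , here)

reach-coStar : ∀ {n k} {A B : Subset (suc n)} → Reach (suc n) k coStar A B → A ≡ B
reach-coStar (here _) = refl
reach-coStar {A = A} (step {B = B} r adjacent walk) =
  contradiction adjacent (heads-meet A B (remaining-head A r) (remaining-head B (reach-remaining walk)))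

coStar-components : ∀ n k → HasComponents (suc n) (suc k) coStar (binomial n k)
coStar-components n k = label , surjective , λ u v → mk⇔ (to u v) (from u v)
  where
  label : RemV (suc n) (suc k) coStar → Fin (binomial n k)
  label (true ∷ A , |A| , _) = rank k A (ℕ.suc-injective |A|)
  surjective : ∀ i → ∃ λ u → ∀ {v} → v ≡ u → label v ≡ i
  surjective i with rank-surjective n k i
  ... | A , p , eq = (true ∷ A , cong suc p , refl) ,
    λ { refl → trans (cong (rank k A) (ℕ.≡-irrelevant _ _)) eq }
  to : ∀ u v → label u ≡ label v → Reach (suc n) (suc k) coStar (proj₁ u) (proj₁ v)
  to (true ∷ A , r) (true ∷ B , _) eq with rank-injective k A B _ _ eq
  ... | refl = here r
  from : ∀ u v → Reach (suc n) (suc k) coStar (proj₁ u) (proj₁ v) → label u ≡ label v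
  from (true ∷ A , |A| , _) (true ∷ B , |B| , _) walk with reach-coStar walk
  ... | refl = cong (rank k A) (ℕ.≡-irrelevant _ _)

coStar-cut : IsVertexCut 11 4 coStar
coStar-cut = A , B , (refl , refl) , (refl , refl) , λ walk → contradiction (reach-coStar walk) λ ()
  where
  A B : Subset 11
  A = true ∷ true  ∷ true ∷ true ∷ false ∷ false ∷ false ∷ false ∷ false ∷ false ∷ false ∷ []
  B = true ∷ false ∷ true ∷ true ∷ true  ∷ false ∷ false ∷ false ∷ false ∷ false ∷ false ∷ []

theorem25 : ((S : VSet 11) (c : ℕ) → IsVertexCut 11 4 S → HasComponents 11 4 S c →
    7 ℕ.* c ℕ.≤ 4 ℕ.* card 11 4 S)
    × Σ (VSet 11) (λ S → Σ ℕ λ c → IsVertexCut 11 4 S × HasComponents 11 4 S c ×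
    4 ℕ.* card 11 4 S ≡ 7 ℕ.* c)
    × ((S : VSet 11) (c : ℕ) → IsVertexCut 11 4 S → HasComponents 11 4 S c →
    4 ℕ.* card 11 4 S ≡ 7 ℕ.* c →
    Σ (VSet 11) λ I → IsMaxIndependent 11 4 I × IsComplementOf 11 4 S I)
theorem25 = bound , (coStar , 120 , coStar-cut , coStar-components 10 3 , refl) , extremal
  where
  bound : (S : VSet 11) (c : ℕ) → IsVertexCut 11 4 S → HasComponents 11 4 S c →
    7 ℕ.* c ℕ.≤ 4 ℕ.* card 11 4 S
  bound S c cut components with ℕ.≤-total (7 ℕ.* c) (4 ℕ.* card 11 4 S)
  ... | inj₁ 7c≤4s = 7c≤4s
  ... | inj₂ 4s≤7c = ℕ.≤-reflexive (trans (cong (7 ℕ.*_) c≡120) (sym (cong (4 ℕ.*_) card≡210)))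
    where open Extremal cut components 4s≤7c

  extremal : (S : VSet 11) (c : ℕ) → IsVertexCut 11 4 S → HasComponents 11 4 S c →
    4 ℕ.* card 11 4 S ≡ 7 ℕ.* c →
    Σ (VSet 11) λ I → IsMaxIndependent 11 4 I × IsComplementOf 11 4 S I
  extremal S c cut components 4s≡7c = not ∘ S , (rest-independent , maximum) ,
    λ A _ → sym (not-involutive (S A))
    where
    open Extremal cut components (ℕ.≤-reflexive 4s≡7c)
    maximum : (J : VSet 11) → IsIndependent 11 4 J → card 11 4 J ℕ.≤ card 11 4 (not ∘ S)
    maximum J independent = subst (card 11 4 J ℕ.≤_)
      (sym (ℤ.+-injective (trans (card-as-total 11 4 (not ∘ S)) N≡120))) (independent-card J independent)
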